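{- Let $H<H'$ be consecutive highly composite numbers. Then no element of the closed exponent box $\mathcal B(H,H')$ lies numerically strictly between $H$ and $H'$; that is, $$\mathcal B(H,H')\cap(H,H')=\varnothing,$$ where $(H,H')$ is the open interval.
   Context: $d(n)$ denotes the number of positive divisors of $n$. A positive integer $H$ is highly composite if $d(m)<d(H)$ for all integers $1\le m<H$. Two highly composite numbers $H<H'$ are consecutive if no highly composite number lies strictly between them. For $m=\prod_p p^{a_p}$ and $n=\prod_p p^{b_p}$, the closed exponent box is $$\mathcal B(m,n)=\Bigl\{\prod_p p^{e_p}:\ \min(a_p,b_p)\le e_p\le\max(a_p,b_p)\text{ for all primes }p\Bigr\}.$$ -}

module Defs where

open import Data.List.Base using (List; length; filter; map; upTo; applyUpTo)
open import Data.Nat.Base using (ℕ; suc; _^_; _≤_; _<_; _⊓_; _⊔_; NonZero)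
open import Data.Nat.Divisibility using (_∣?_)
open import Data.Nat.ListAction using (product)
open import Data.Nat.Primality using (Prime; prime?)
open import Data.Nat.Primality.Factorisation using (factors; factorise)
open import Data.Nat.Properties using (_≟_)
open import Data.Product.Base using (_×_; ∃-syntax)
open import Level using (0ℓ)
open import Relation.Binary.PropositionalEquality.Core using (_≡_)
open import Relation.Nullary.Negation.Core using (¬_)
open import Relation.Unary using (Pred)

d : ℕ → ℕ
d n = length (filter (_∣? n) (applyUpTo suc n))

record HighlyComposite (H : ℕ) : Set where
  field
    positive : 1 ≤ H
    maximal  : ∀ m → 1 ≤ m → m < H → d m < d H

record Consecutive (H H′ : ℕ) : Set where
  field
    lower   : HighlyComposite H
    upper   : HighlyComposite H′
    ordered : H < H′
    noneBetween : ∀ K → HighlyComposite K → ¬ (H < K × K < H′)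

exponent : (p n : ℕ) → .{{NonZero n}} → ℕ
exponent p n = length (filter (p ≟_) (factors (factorise n)))

primesUpTo : ℕ → List ℕ
primesUpTo N = filter prime? (upTo (suc N))

-- Only the values of e at primes matter.
primePowerProduct : ℕ → (ℕ → ℕ) → ℕ
primePowerProduct N e = product (map (λ p → p ^ e p) (primesUpTo N))

-- Primes exceeding both m and n divide neither, so the bounds force e p ≡ 0
-- there, and the product over all primes is the product over p ≤ m ⊔ n.
ℬ : (m n : ℕ) → .{{NonZero m}} → .{{NonZero n}} → Pred ℕ 0ℓ
ℬ m n x = ∃[ e ]
  ( (∀ p → Prime p → exponent p m ⊓ exponent p n ≤ e p
                   × e p ≤ exponent p m ⊔ exponent p n)
  × x ≡ primePowerProduct (m ⊔ n) e )

OpenInterval : ℕ → ℕ → Pred ℕ 0ℓ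
OpenInterval a b x = a < x × x < b

{-# OPTIONS --safe #-}
module Submission where

-- Let x be in the box with H < x < H′. The complementary number y = H H′ / x is
-- also in the box, and also satisfies H < y < H′. Since t ↦ (t + 1)(a + b − t + 1)
-- is concave and symmetric, it is smallest at the ends of the interval between a
-- and b, so multiplying over the primes gives d(H) d(H′) ≤ d(x) d(y). But no
-- number below H′ has more divisors than H, hence d(x) d(y) ≤ d(H)² < d(H) d(H′).

open import Defs
open import Data.List.Base using (List; []; _∷_; _++_; length; filter; map; upTo; applyUpTo)
open import Data.List.Membership.Propositional using (_∈_; _∉_)
open import Data.List.Membership.Propositional.Properties using (∈-map⁺; ∈-map⁻; ∈-++⁺ˡ; ∈-++⁺ʳ; ∈-++⁻; ∈-applyUpTo⁺; ∈-upTo⁺; ∈-filter⁺; ∈-filter⁻)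
open import Data.List.Membership.Propositional.Properties.WithK using (unique∧set⇒bag)
open import Data.List.Properties using (length-++; length-map; map-cong-local; filter-accept; filter-reject)
open import Data.List.Relation.Binary.BagAndSetEquality using (∼bag⇒↭)
open import Data.List.Relation.Binary.Disjoint.Propositional using (Disjoint)
open import Data.List.Relation.Binary.Permutation.Propositional.Properties using (↭-length)
open import Data.List.Relation.Unary.All as All using (All; []; _∷_)
open import Data.List.Relation.Unary.All.Properties using (all-filter)
open import Data.List.Relation.Unary.AllPairs using ([]; _∷_)
open import Data.List.Relation.Unary.Any using (here; there)
open import Data.List.Relation.Unary.Unique.Propositional using (Unique)
open import Data.List.Relation.Unary.Unique.Propositional.Properties using (map⁺; ++⁺; filter⁺; upTo⁺; applyUpTo⁺₁; Unique[x∷xs]⇒x∉xs)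
open import Data.Nat.Base using (ℕ; zero; suc; _+_; _*_; _∸_; _^_; _≤_; _<_; _⊓_; _⊔_; s≤s; NonZero; >-nonZero)
open import Data.Nat.Divisibility using (_∣_; _∤_; _∣?_; divides; ∣-trans; ∣n⇒∣m*n; ∣⇒≤; ∣1⇒≡1; _∣0; m∣m*n; 0∣⇒≡0; *-monoʳ-∣; *-cancelˡ-∣)
open import Data.Nat.Induction using (<-rec)
open import Data.Nat.ListAction using (product)
open import Data.Nat.ListAction.Properties using (∈⇒∣product)
open import Data.Nat.Primality using (Prime; prime?; euclidsLemma; prime⇒irreducible; prime⇒nonZero; ¬prime[1])
open import Data.Nat.Primality.Factorisation using (factors; factorise; module PrimeFactorisation)
open import Data.Nat.Properties
open import Data.Nat.Tactic.RingSolver using (solve-∀)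
open import Data.Product.Base using (_×_; _,_; proj₁; proj₂; ∃-syntax)
open import Data.Sum.Base using (_⊎_; inj₁; inj₂; [_,_]′)
open import Function.Base using (_∘_)
open import Function.Bundles using (mk⇔)
open import Relation.Binary.PropositionalEquality using (_≡_; refl; sym; trans; cong; cong₂; subst; module ≡-Reasoning)
open import Relation.Nullary.Decidable.Core using (yes; no)
open import Relation.Nullary.Negation.Core using (contradiction)
open import Relation.Unary using (Empty; _∩_)

-- Finite products indexed by a list.

∏ : List ℕ → (ℕ → ℕ) → ℕ
∏ ps f = product (map f ps)

module _ {f g : ℕ → ℕ} where

  ∏-cong : ∀ {ps} → All (λ p → f p ≡ g p) ps → ∏ ps f ≡ ∏ ps g
  ∏-cong f≗g = cong product (map-cong-local f≗g)

  ∏-mono-≤ : ∀ {ps} → All (λ p → f p ≤ g p) ps → ∏ ps f ≤ ∏ ps g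
  ∏-mono-≤ []           = ≤-refl
  ∏-mono-≤ (f≤g ∷ fs≤gs) = *-mono-≤ f≤g (∏-mono-≤ fs≤gs)

  ∏-distrib-* : ∀ ps → ∏ ps (λ p → f p * g p) ≡ ∏ ps f * ∏ ps g
  ∏-distrib-* []       = refl
  ∏-distrib-* (p ∷ ps) = trans (cong (f p * g p *_) (∏-distrib-* ps))
    ([m*n]*[o*p]≡[m*o]*[n*p] (f p) (g p) (∏ ps f) (∏ ps g))

∏-const-1 : ∀ ps → ∏ ps (λ _ → 1) ≡ 1
∏-const-1 []       = refl
∏-const-1 (p ∷ ps) = trans (*-identityˡ _) (∏-const-1 ps)

-- Prime divisors of products of prime powers.

prime∣prime⇒≡ : ∀ {p q} → Prime p → Prime q → p ∣ q → p ≡ q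
prime∣prime⇒≡ pp pq p∣q with prime⇒irreducible pq p∣q
... | inj₁ refl = contradiction pp ¬prime[1]
... | inj₂ p≡q  = p≡q

prime∣^⇒∣ : ∀ {p} q k → Prime p → p ∣ q ^ k → p ∣ q
prime∣^⇒∣ q zero    pp p∣1 with refl ← ∣1⇒≡1 p∣1 = contradiction pp ¬prime[1]
prime∣^⇒∣ q (suc k) pp p∣q^k+1 with euclidsLemma q (q ^ k) pp p∣q^k+1
... | inj₁ p∣q   = p∣q
... | inj₂ p∣q^k = prime∣^⇒∣ q k pp p∣q^k

-- Provides the coprimality that `d-∏` needs to split the power of the first prime off a product. By
-- Euclid's lemma, `p` would have to equal one of the listed primes.
prime∉⇒∤∏ : ∀ {p} (e : ℕ → ℕ) ps → Prime p → All Prime ps → p ∉ ps → p ∤ ∏ ps (λ q → q ^ e q)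
prime∉⇒∤∏ e []       pp _           _ p∣1 with refl ← ∣1⇒≡1 p∣1 = ¬prime[1] pp
prime∉⇒∤∏ e (q ∷ qs) pp (pq ∷ pqs) p∉q∷qs p∣
  with euclidsLemma (q ^ e q) (∏ qs (λ r → r ^ e r)) pp p∣
... | inj₁ p∣q^k = p∉q∷qs (here (prime∣prime⇒≡ pp pq (prime∣^⇒∣ q (e q) pp p∣q^k)))
... | inj₂ p∣∏   = prime∉⇒∤∏ e qs pp pqs (p∉q∷qs ∘ there) p∣∏

-- The divisor count of a product of prime powers.

divisors : ℕ → List ℕ
divisors n = filter (_∣? n) (applyUpTo suc n)

divisors-unique : ∀ n → Unique (divisors n)
divisors-unique n = filter⁺ (_∣? n)
  (applyUpTo⁺₁ suc n (λ i<j _ → <⇒≢ (s≤s i<j)))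

∈-divisors⁺ : ∀ {z n} .{{_ : NonZero n}} → z ∣ n → z ∈ divisors n
∈-divisors⁺ {zero}  {suc _} 0∣n = contradiction (0∣⇒≡0 0∣n) (λ ())
∈-divisors⁺ {suc z} {n}     z∣n = ∈-filter⁺ (_∣? n) (∈-applyUpTo⁺ suc (∣⇒≤ z∣n)) z∣n

∈-divisors⁻ : ∀ {z} n → z ∈ divisors n → z ∣ n
∈-divisors⁻ n z∈ = proj₂ (∈-filter⁻ (_∣? n) {xs = applyUpTo suc n} z∈)

-- Write `p * n` as `q * z`. The prime `p` divides `q` or `z`; cancelling it gives `z ∣ n` in the
-- first case and a cofactor `j` dividing `n` in the second.
∣p*n⇒ : ∀ {p z} n → Prime p → z ∣ p * n → z ∣ n ⊎ ∃[ j ] (j ∣ n × z ≡ p * j)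
∣p*n⇒ {p} {z} n pp (divides q pn≡qz)
  with euclidsLemma q z pp (divides n (trans (sym pn≡qz) (*-comm p n)))
... | inj₁ (divides q′ refl) = inj₁ (divides q′ (*-cancelˡ-≡ n (q′ * z) p {{prime⇒nonZero pp}}
        (trans pn≡qz (swap q′ p z))))
  where
  swap : ∀ a b c → a * b * c ≡ b * (a * c)
  swap = solve-∀
... | inj₂ (divides j refl) = inj₂ (j , divides q (*-cancelˡ-≡ n (q * j) p {{prime⇒nonZero pp}}
        (trans pn≡qz (swap q j p))) , *-comm j p)
  where
  swap : ∀ a b c → a * (b * c) ≡ c * (a * b)
  swap = solve-∀

-- Factors `p` are peeled off `z` one at a time. Either the peeling stops early, and then one power
-- of `p` can be spared, or `z` carries all of `p ^ suc k`.
∣p^[1+k]*m⇒ : ∀ {p z} k m → Prime p → z ∣ p ^ suc k * m →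
              z ∣ p ^ k * m ⊎ ∃[ j ] (j ∣ m × z ≡ p ^ suc k * j)
∣p^[1+k]*m⇒ {p} {z} k m pp z∣ with ∣p*n⇒ (p ^ k * m) pp (subst (z ∣_) (*-assoc p (p ^ k) m) z∣)
... | inj₁ z∣p^k*m = inj₁ z∣p^k*m
∣p^[1+k]*m⇒ {p} zero m pp _ | inj₂ (j , j∣1*m , refl) =
  inj₂ (j , subst (j ∣_) (*-identityˡ m) j∣1*m , cong (_* j) (sym (*-identityʳ p)))
∣p^[1+k]*m⇒ {p} (suc k) m pp _ | inj₂ (j , j∣ , refl) with ∣p^[1+k]*m⇒ k m pp j∣
... | inj₁ j∣p^k*m = inj₁ (subst (p * j ∣_) (sym (*-assoc p (p ^ k) m)) (*-monoʳ-∣ p j∣p^k*m))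
... | inj₂ (i , i∣m , refl) = inj₂ (i , i∣m , sym (*-assoc p (p ^ suc k) i))

module _ {p m : ℕ} (pp : Prime p) (p∤m : p ∤ m) where

  private
    instance
      m≢0 : NonZero m
      m≢0 = >-nonZero (n≢0⇒n>0 λ { refl → p∤m (p ∣0) })

      p≢0 : NonZero p
      p≢0 = prime⇒nonZero pp

    p^k≢0 : ∀ k → NonZero (p ^ k)
    p^k≢0 k = m^n≢0 p k

    p^k*m≢0 : ∀ k → NonZero (p ^ k * m)
    p^k*m≢0 k = m*n≢0 (p ^ k) m {{p^k≢0 k}}

  -- Passing from `p ^ k * m` to `p ^ suc k * m` keeps the `old` divisors and adds the `new` ones,
  -- which carry the full power of `p`. Two duplicate-free lists with the same elements are
  -- permutations of each other, so comparing lengths compares divisor counts.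
  d[p^[1+k]*m] : ∀ k → d (p ^ suc k * m) ≡ d (p ^ k * m) + d m
  d[p^[1+k]*m] k = begin
    length (divisors (p ^ suc k * m))               ≡⟨ ↭-length (∼bag⇒↭ (unique∧set⇒bag
                                                         (divisors-unique (p ^ suc k * m)) old++new-unique (mk⇔ to from))) ⟩
    length (old ++ new)                             ≡⟨ length-++ old ⟩
    length old + length new                         ≡⟨ cong (length old +_) (length-map (p ^ suc k *_) (divisors m)) ⟩
    d (p ^ k * m) + d m                             ∎
    where
    open ≡-Reasoning
    old = divisors (p ^ k * m)
    new = map (p ^ suc k *_) (divisors m)

    -- If `p ^ suc k * j` divided `p ^ k * m`, cancelling `p ^ k` would leave `p * j ∣ m`, against
    -- `p ∤ m`.
    disjoint : Disjoint old new
    disjoint (z∈old , z∈new) with j , _ , refl ← ∈-map⁻ (p ^ suc k *_) z∈new =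
      p∤m (∣-trans (m∣m*n j) (*-cancelˡ-∣ (p ^ k) {{p^k≢0 k}}
        (subst (_∣ p ^ k * m) (trans (cong (_* j) (*-comm p (p ^ k))) (*-assoc (p ^ k) p j))
          (∈-divisors⁻ (p ^ k * m) z∈old))))

    old++new-unique : Unique (old ++ new)
    old++new-unique = ++⁺ (divisors-unique (p ^ k * m))
      (map⁺ (*-cancelˡ-≡ _ _ (p ^ suc k) {{p^k≢0 (suc k)}}) (divisors-unique m)) disjoint

    to : ∀ {z} → z ∈ divisors (p ^ suc k * m) → z ∈ old ++ new
    to z∈ with ∣p^[1+k]*m⇒ k m pp (∈-divisors⁻ (p ^ suc k * m) z∈)
    ... | inj₁ z∣              = ∈-++⁺ˡ (∈-divisors⁺ {{p^k*m≢0 k}} z∣)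
    ... | inj₂ (j , j∣m , refl) = ∈-++⁺ʳ old (∈-map⁺ (p ^ suc k *_) (∈-divisors⁺ j∣m))

    from : ∀ {z} → z ∈ old ++ new → z ∈ divisors (p ^ suc k * m)
    from {z} z∈ with ∈-++⁻ old z∈
    ... | inj₁ z∈old = ∈-divisors⁺ {{p^k*m≢0 (suc k)}} (subst (z ∣_) (sym (*-assoc p (p ^ k) m))
                         (∣n⇒∣m*n p (∈-divisors⁻ (p ^ k * m) z∈old)))
    ... | inj₂ z∈new with j , j∈ , refl ← ∈-map⁻ (p ^ suc k *_) z∈new =
      ∈-divisors⁺ {{p^k*m≢0 (suc k)}} (*-monoʳ-∣ (p ^ suc k) (∈-divisors⁻ m j∈))

  d[p^k*m] : ∀ k → d (p ^ k * m) ≡ suc k * d m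
  d[p^k*m] zero    = trans (cong d (*-identityˡ m)) (sym (*-identityˡ (d m)))
  d[p^k*m] (suc k) = trans (d[p^[1+k]*m] k)
    (trans (cong (_+ d m) (d[p^k*m] k)) (+-comm (suc k * d m) (d m)))

-- Since the primes in the list are distinct, the first prime does not divide the product over the
-- others, so its power contributes the factor `suc (e p)`.
d-∏ : ∀ (e : ℕ → ℕ) {ps} → All Prime ps → Unique ps → d (∏ ps (λ p → p ^ e p)) ≡ ∏ ps (suc ∘ e)
d-∏ e {[]}     _          _  = refl
d-∏ e {p ∷ ps} (pp ∷ pps) u@(_ ∷ us) =
  trans (d[p^k*m] pp (prime∉⇒∤∏ e ps pp pps (Unique[x∷xs]⇒x∉xs u)) (e p))
        (cong (suc (e p) *_) (d-∏ e pps us))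

-- Recovering a number from its exponents.

multiplicity : ℕ → List ℕ → ℕ
multiplicity p fs = length (filter (p ≟_) fs)

-- The new factor raises only the exponent of `q`, and `q` occurs exactly once in `ps`, so the
-- product gains a single factor `q`.
∏-multiplicity-∷ : ∀ {q ps} fs → Unique ps → q ∈ ps →
  ∏ ps (λ p → p ^ multiplicity p (q ∷ fs)) ≡ q * ∏ ps (λ p → p ^ multiplicity p fs)
∏-multiplicity-∷ {q} {.q ∷ ps} fs (q≢ps ∷ _) (here refl) = trans
  (cong₂ _*_ (cong (λ l → q ^ length l) (filter-accept (q ≟_) refl))
             (∏-cong (All.map (λ {p} q≢p → cong (λ l → p ^ length l)
               (filter-reject (p ≟_) (q≢p ∘ sym))) q≢ps)))
  (*-assoc q (q ^ multiplicity q fs) _)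
∏-multiplicity-∷ {q} {p ∷ ps} fs (p≢ps ∷ u) (there q∈ps) = trans
  (cong₂ _*_ (cong (λ l → p ^ length l) (filter-reject (p ≟_) (All.lookup p≢ps q∈ps)))
             (∏-multiplicity-∷ fs u q∈ps))
  (swap (p ^ multiplicity p fs) q _)
  where
  swap : ∀ a b c → a * (b * c) ≡ b * (a * c)
  swap = solve-∀

∏-multiplicity : ∀ {ps fs} → Unique ps → All (_∈ ps) fs →
  ∏ ps (λ p → p ^ multiplicity p fs) ≡ product fs
∏-multiplicity {ps} u []          = ∏-const-1 ps
∏-multiplicity {ps} {q ∷ fs} u (q∈ps ∷ fs∈ps) =
  trans (∏-multiplicity-∷ fs u q∈ps) (cong (q *_) (∏-multiplicity u fs∈ps))

primesUpTo-prime : ∀ N → All Prime (primesUpTo N)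
primesUpTo-prime N = all-filter prime? (upTo (suc N))

primesUpTo-unique : ∀ N → Unique (primesUpTo N)
primesUpTo-unique N = filter⁺ prime? (upTo⁺ (suc N))

-- `exponent p n` is the multiplicity of `p` among the prime factors of `n`, all of which are at
-- most `n`. The free bound `N` lets two numbers be expanded over one common list of primes.
primePowerProduct-exponent : ∀ {N} n .{{_ : NonZero n}} → n ≤ N →
  primePowerProduct N (λ p → exponent p n) ≡ n
primePowerProduct-exponent {N} n n≤N = trans
  (∏-multiplicity (primesUpTo-unique N) (All.tabulate factor∈primes))
  (sym isFactorisation)
  where
  open PrimeFactorisation (factorise n) using (isFactorisation; factorsPrime)

  factor∈primes : ∀ {q} → q ∈ factors (factorise n) → q ∈ primesUpTo N
  factor∈primes {q} q∈ = ∈-filter⁺ prime?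
    (∈-upTo⁺ (s≤s (≤-trans (∣⇒≤ (subst (q ∣_) (sym isFactorisation) (∈⇒∣product q∈))) n≤N)))
    (All.lookup factorsPrime q∈)

-- The concavity inequality at a single prime.

sorted-box-≤ : ∀ {a b e} → a ≤ e → e ≤ b → suc a * suc b ≤ suc e * suc (a + b ∸ e)
sorted-box-≤ {a} a≤e e≤b
  with i , refl ← m≤n⇒∃[o]m+o≡n a≤e
  with j , refl ← m≤n⇒∃[o]m+o≡n e≤b = begin
  -- Here `e` is `a + i` and `b` is `a + i + j`, so the complementary exponent is `a + j`, and the
  -- two products differ by exactly `i * j`.
  suc a * suc (a + i + j)                        ≤⟨ m≤m+n _ (i * j) ⟩
  suc a * suc (a + i + j) + i * j                ≡⟨ expand a i j ⟩
  suc (a + i) * suc (a + j)                      ≡⟨ cong (λ t → suc (a + i) * suc t) (m+n∸n≡m (a + j) (a + i)) ⟨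
  suc (a + i) * suc (a + j + (a + i) ∸ (a + i))  ≡⟨ cong (λ t → suc (a + i) * suc (t ∸ (a + i))) (rearrange a i j) ⟩
  suc (a + i) * suc (a + (a + i + j) ∸ (a + i))  ∎
  where
  open ≤-Reasoning
  expand : ∀ a i j → suc a * suc (a + i + j) + i * j ≡ suc (a + i) * suc (a + j)
  expand = solve-∀
  rearrange : ∀ a i j → a + j + (a + i) ≡ a + (a + i + j)
  rearrange = solve-∀

-- Both sides are symmetric in `a` and `b`, so the sorted case suffices. Either order can occur, as
-- a prime may have a smaller exponent in the larger number.
box-≤ : ∀ a b {e} → a ⊓ b ≤ e → e ≤ a ⊔ b → suc a * suc b ≤ suc e * suc (a + b ∸ e)
box-≤ a b {e} lo hi with ≤-total a b
... | inj₁ a≤b = sorted-box-≤ (subst (_≤ e) (m≤n⇒m⊓n≡m a≤b) lo) (subst (e ≤_) (m≤n⇒m⊔n≡n a≤b) hi)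
... | inj₂ b≤a rewrite *-comm (suc a) (suc b) | +-comm a b =
  sorted-box-≤ (subst (_≤ e) (m≥n⇒m⊓n≡n b≤a) lo) (subst (e ≤_) (m≥n⇒m⊔n≡m b≤a) hi)

-- Divisor counts below the larger of two consecutive highly composite numbers.

d≤d[lower] : ∀ {H H′} → Consecutive H H′ → ∀ m → 1 ≤ m → m < H′ → d m ≤ d H
d≤d[lower] {H} {H′} cons = <-rec _ step
  where
  open Consecutive cons
  open HighlyComposite lower

  step : ∀ m → (∀ {k} → k < m → 1 ≤ k → k < H′ → d k ≤ d H) → 1 ≤ m → m < H′ → d m ≤ d H
  step m rec 1≤m m<H′ with m ≤? H
  ... | yes m≤H = [ (λ m<H → <⇒≤ (maximal m 1≤m m<H)) , ≤-reflexive ∘ cong d ]′ (m≤n⇒m<n∨m≡n m≤H)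
  -- By induction every smaller `k` has `d k ≤ d H`. If `d H < d m` held, `m` would thus be a highly
  -- composite number strictly between `H` and `H′`.
  ... | no m≰H  = ≮⇒≥ λ dH<dm → noneBetween m
    (record { positive = 1≤m
            ; maximal  = λ k 1≤k k<m → ≤-<-trans (rec k<m 1≤k (<-trans k<m m<H′)) dH<dm })
    (≰⇒> m≰H , m<H′)

-- The complementary number and the contradiction.

theorem4p2 : (H H′ : ℕ) .{{_ : NonZero H}} .{{_ : NonZero H′}} →
    Consecutive H H′ → Empty (ℬ H H′ ∩ OpenInterval H H′)
theorem4p2 H H′ cons x ((e , inBox , refl) , H<x , x<H′) =
  <⇒≱ dxdy<dHdH′ dHdH′≤dxdy
  where
  open Consecutive cons
  N = H ⊔ H′
  ps = primesUpTo N

  a b e′ : ℕ → ℕ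
  a p = exponent p H
  b p = exponent p H′
  -- The exponent of `H * H′ / x` at `p`. By `e≤a+b` the subtraction does not truncate at primes,
  -- the only places where its value enters.
  e′ p = a p + b p ∸ e p

  y = primePowerProduct N e′

  H≡ : primePowerProduct N a ≡ H
  H≡ = primePowerProduct-exponent H (m≤m⊔n H H′)

  H′≡ : primePowerProduct N b ≡ H′
  H′≡ = primePowerProduct-exponent H′ (m≤n⊔m H H′)

  e≤a+b : ∀ {p} → Prime p → e p ≤ a p + b p
  e≤a+b {p} pp = ≤-trans (proj₂ (inBox p pp)) (m⊔n≤m+n (a p) (b p))

  ∏-split : ∀ f g → ∏ ps (λ p → p ^ (f p + g p)) ≡ primePowerProduct N f * primePowerProduct N g
  ∏-split f g = trans (∏-cong (All.universal (λ p → ^-distribˡ-+-* p (f p) (g p)) ps)) (∏-distrib-* ps)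

  xy≡HH′ : x * y ≡ H * H′
  xy≡HH′ = begin
    x * y                          ≡⟨ ∏-split e e′ ⟨
    ∏ ps (λ p → p ^ (e p + e′ p))   ≡⟨ ∏-cong (All.map (λ {p} pp → cong (p ^_) (m+[n∸m]≡n (e≤a+b pp))) (primesUpTo-prime N)) ⟩
    ∏ ps (λ p → p ^ (a p + b p))    ≡⟨ ∏-split a b ⟩
    primePowerProduct N a * primePowerProduct N b ≡⟨ cong₂ _*_ H≡ H′≡ ⟩
    H * H′                         ∎
    where open ≡-Reasoning

  -- As `x * y` equals `H * H′`, having `x` below `H′` forces `y` above `H`; symmetrically, `x`
  -- above `H` forces `y` below `H′`.
  H<y : H < y
  H<y = ≰⇒> λ y≤H → <-irrefl xy≡HH′ (begin-strict
    x * y   ≤⟨ *-monoʳ-≤ x y≤H ⟩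
    x * H   <⟨ *-monoˡ-< H x<H′ ⟩
    H′ * H  ≡⟨ *-comm H′ H ⟩
    H * H′  ∎)
    where open ≤-Reasoning

  y<H′ : y < H′
  y<H′ = ≰⇒> λ H′≤y → <-irrefl (sym xy≡HH′) (begin-strict
    H * H′  <⟨ *-monoˡ-< H′ H<x ⟩
    x * H′  ≤⟨ *-monoʳ-≤ x H′≤y ⟩
    x * y   ∎)
    where open ≤-Reasoning

  dx≤dH : d x ≤ d H
  dx≤dH = d≤d[lower] cons x (m<n⇒0<n H<x) x<H′

  dy≤dH : d y ≤ d H
  dy≤dH = d≤d[lower] cons y (m<n⇒0<n H<y) y<H′

  d-ppp : ∀ f → d (primePowerProduct N f) ≡ ∏ ps (suc ∘ f)
  d-ppp f = d-∏ f (primesUpTo-prime N) (primesUpTo-unique N)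

  dH<dH′ : d H < d H′
  dH<dH′ = HighlyComposite.maximal upper H (HighlyComposite.positive lower) ordered

  dxdy<dHdH′ : d x * d y < d H * d H′
  dxdy<dHdH′ = begin-strict
    d x * d y   ≤⟨ *-mono-≤ dx≤dH dy≤dH ⟩
    d H * d H   <⟨ *-monoʳ-< (d H) {{>-nonZero 0<dH}} dH<dH′ ⟩
    d H * d H′  ∎
    where
    open ≤-Reasoning
    0<dH : 0 < d H
    -- `d 1` computes to 1, and 1 lies below `H′` because `1 ≤ H < H′`.
    0<dH = d≤d[lower] cons 1 ≤-refl (≤-<-trans (HighlyComposite.positive lower) ordered)

  dHdH′≤dxdy : d H * d H′ ≤ d x * d y
  dHdH′≤dxdy = begin
    -- Expanding all four numbers over the same list `ps` turns both sides into products that can be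
    -- compared prime by prime with `box-≤`.
    d H * d H′                                ≡⟨ cong₂ (λ m n → d m * d n) H≡ H′≡ ⟨
    d (primePowerProduct N a) * d (primePowerProduct N b) ≡⟨ cong₂ _*_ (d-ppp a) (d-ppp b) ⟩
    ∏ ps (suc ∘ a) * ∏ ps (suc ∘ b)           ≡⟨ ∏-distrib-* ps ⟨
    ∏ ps (λ p → suc (a p) * suc (b p))        ≤⟨ ∏-mono-≤ (All.map (λ {p} pp →
                                                   box-≤ (a p) (b p) (proj₁ (inBox p pp)) (proj₂ (inBox p pp)))
                                                   (primesUpTo-prime N)) ⟩
    ∏ ps (λ p → suc (e p) * suc (e′ p))       ≡⟨ ∏-distrib-* ps ⟩
    ∏ ps (suc ∘ e) * ∏ ps (suc ∘ e′)          ≡⟨ cong₂ _*_ (d-ppp e) (d-ppp e′) ⟨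
    d x * d y                                 ∎
    where open ≤-Reasoning
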